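{- Let $F\neq\{0\}$ be a finite abelian group, and let $A$ and $A_1$ be skew braces on $F\times\mathbb{Z}/2\mathbb{Z}$ constructed from data $(\phi,y,z)$ and $(\phi_1,y_1,z_1)$ respectively, as described in the context. Then $A$ and $A_1$ are isomorphic if and only if there exists $\sigma\in\operatorname{Aut}(F)$ such that $\phi_1=\sigma\circ\phi\circ\sigma^{ -1}$, $\sigma(y)=y_1$, and $z_1-\sigma(z)\in\phi_1(F)$.
   Context: Admissible data on a finite abelian group $F\ne\{0\}$: a triple $(\phi,y,z)$ with $\phi\in\operatorname{End}(F)$, $y,z\in F$, $2y=0$, $\phi(z)=\phi(y)-2z$, $\phi(\phi(f))=-2\phi(f)$ for all $f\in F$, and such that the map $\psi\colon F\times\mathbb{Z}/2\mathbb{Z}\times\mathbb{Z}/2\mathbb{Z}\to F$, $\psi(f,k_1,k_2)=[k_2](\phi(f)-[k_1]z)$, is surjective. Here for $k\in\mathbb{Z}/2\mathbb{Z}$, $[k]\in\{0,1\}$ is its representative. The skew brace built from $(\phi,y,z)$ is the set $F\times\mathbb{Z}/2\mathbb{Z}$ with $(f_1,k_1)+(f_2,k_2)=(f_1+(-1)^{k_1}f_2+[k_1][k_2]y,\,k_1+k_2)$ and $(f_1,k_1)\circ(f_2,k_2)=(f_1+(-1)^{k_1}f_2+\psi(f_1,k_1,k_2)+[k_1][k_2]y,\,k_1+k_2)$. (A skew brace is a triple $(A,+,\circ)$ of two group structures with $a\circ(b+c)=a\circ b-a+a\circ c$; an isomorphism of skew braces is a bijection that is a homomorphism for both operations.)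 -}

module Defs where

open import Algebra.Bundles using (AbelianGroup; Group; RawGroup)
open import Algebra.Morphism.Bundles using (GroupHomomorphism)
open import Algebra.Morphism.Structures using (IsGroupHomomorphism; IsGroupIsomorphism)
open import Algebra.Structures using (IsGroup; IsMonoid)
import Algebra.Definitions.RawMonoid as RawMonoidDefinitions
import Algebra.Properties.AbelianGroup as AbelianGroupProperties
import Algebra.Solver.CommutativeMonoid as CommutativeMonoidSolver
open import Data.Fin.Base using (Fin)
open import Data.Nat.Base using (ℕ)
open import Data.Parity.Base as ℙ using (Parity; 0ℙ; 1ℙ)
import Data.Parity.Properties as ℙ
open import Data.Product.Base using (∃; _×_; _,_; proj₁; proj₂)
open import Data.Product.Relation.Binary.Pointwise.NonDependent using (Pointwise; ×-isEquivalence)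
open import Function.Bundles using (Inverse)
open import Function.Definitions using (Bijective; StrictlySurjective)
open import Level using (_⊔_; suc)
open import Relation.Binary.Bundles using (Setoid)
open import Relation.Binary.PropositionalEquality.Core as ≡ using (_≡_)
import Relation.Binary.PropositionalEquality.Properties as ≡
open import Relation.Binary.Core using (Rel)
open import Relation.Binary.Structures using (IsEquivalence)
import Relation.Binary.Reasoning.Setoid as SetoidReasoning

Finite : ∀ {c ℓ} → Setoid c ℓ → Set (c ⊔ ℓ)
Finite S = ∃ λ n → Inverse S (≡.setoid (Fin n))

record SkewBrace c ℓ : Set (suc (c ⊔ ℓ)) where
  infix  4 _≈_
  infixl 6 _+_
  infixl 7 _∘_
  field
    Carrier   : Set c
    _≈_       : Rel Carrier ℓ
    _+_       : Carrier → Carrier → Carrier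
    0#        : Carrier
    -_        : Carrier → Carrier
    _∘_       : Carrier → Carrier → Carrier
    1#        : Carrier
    _⁻¹       : Carrier → Carrier
    +-isGroup : IsGroup _≈_ _+_ 0# -_
    ∘-isGroup : IsGroup _≈_ _∘_ 1# _⁻¹
    ∘-brace   : ∀ a b c → a ∘ (b + c) ≈ (a ∘ b + (- a)) + a ∘ c

  +-group : Group c ℓ
  +-group = record { isGroup = +-isGroup }

  ∘-group : Group c ℓ
  ∘-group = record { isGroup = ∘-isGroup }

  +-rawGroup : RawGroup c ℓ
  +-rawGroup = Group.rawGroup +-group

  ∘-rawGroup : RawGroup c ℓ
  ∘-rawGroup = Group.rawGroup ∘-group

record IsSkewBraceIsomorphism {a b ℓ₁ ℓ₂} (A : SkewBrace a ℓ₁) (B : SkewBrace b ℓ₂)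
    (θ : SkewBrace.Carrier A → SkewBrace.Carrier B) : Set (a ⊔ b ⊔ ℓ₁ ⊔ ℓ₂) where
  private
    module A = SkewBrace A
    module B = SkewBrace B
  field
    +-isGroupHomomorphism : IsGroupHomomorphism A.+-rawGroup B.+-rawGroup θ
    ∘-isGroupHomomorphism : IsGroupHomomorphism A.∘-rawGroup B.∘-rawGroup θ
    bijective             : Bijective A._≈_ B._≈_ θ

infix 4 _≅_

_≅_ : ∀ {a b ℓ₁ ℓ₂} → SkewBrace a ℓ₁ → SkewBrace b ℓ₂ → Set (a ⊔ b ⊔ ℓ₁ ⊔ ℓ₂)
A ≅ B = ∃ (IsSkewBraceIsomorphism A B)

Endomorphism : ∀ {c ℓ} → AbelianGroup c ℓ → Set (c ⊔ ℓ)
Endomorphism F = GroupHomomorphism rawGroup rawGroup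
  where open AbelianGroup F using (rawGroup)

record Automorphism {c ℓ} (F : AbelianGroup c ℓ) : Set (c ⊔ ℓ) where
  open AbelianGroup F using (Carrier; rawGroup)
  field
    ⟦_⟧                : Carrier → Carrier
    isGroupIsomorphism : IsGroupIsomorphism rawGroup rawGroup ⟦_⟧

  open IsGroupIsomorphism isGroupIsomorphism public

  -- The preimage chosen by surjectivity; by injectivity it is the only one.
  ⟦_⟧⁻¹ : Carrier → Carrier
  ⟦ f ⟧⁻¹ = proj₁ (surjective f)

-- Parity plays the role of ℤ/2ℤ; [ k ] is the representative of k in {0, 1}.
[_] : Parity → ℕ
[ 0ℙ ] = 0
[ 1ℙ ] = 1

module _ {c ℓ} (F : AbelianGroup c ℓ) where

  open AbelianGroup F renaming (_∙_ to infixl 6 _+_; ε to 0#; _⁻¹ to -_)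
  open RawMonoidDefinitions rawMonoid using () renaming (_×′_ to infixl 8 _·_)

  record AdmissibleData : Set (c ⊔ ℓ) where
    field
      endo : Endomorphism F
      y z  : Carrier

    open GroupHomomorphism endo public using () renaming (⟦_⟧ to φ)

    ψ : Carrier × Parity × Parity → Carrier
    ψ (f , k₁ , k₂) = [ k₂ ] · (φ f - [ k₁ ] · z)

    field
      2y≈0         : 2 · y ≈ 0#
      φz≈φy-2z     : φ z ≈ φ y - 2 · z
      φφ≈-2φ       : ∀ f → φ (φ f) ≈ - (2 · φ f)
      ψ-surjective : StrictlySurjective _≈_ ψ

module Construction {c ℓ} (F : AbelianGroup c ℓ) (d : AdmissibleData F) where

  open AbelianGroup F renaming (_∙_ to infixl 6 _+_; ε to 0#; _⁻¹ to -_)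
  open RawMonoidDefinitions rawMonoid using () renaming (_×′_ to infixl 8 _·_)
  open AdmissibleData d

  -- signed k f is (-1)ᵏ f.
  signed : Parity → Carrier → Carrier
  signed 0ℙ f = f
  signed 1ℙ f = - f

  B : Set c
  B = Carrier × Parity

  infix  4 _≈ᴮ_
  infixl 6 _+ᴮ_
  infixl 7 _∘ᴮ_

  _≈ᴮ_ : Rel B ℓ
  _≈ᴮ_ = Pointwise _≈_ _≡_

  _+ᴮ_ : B → B → B
  (f₁ , k₁) +ᴮ (f₂ , k₂) =
    f₁ + signed k₁ f₂ + [ k₁ ] · ([ k₂ ] · y) , k₁ ℙ.+ k₂

  _∘ᴮ_ : B → B → B
  (f₁ , k₁) ∘ᴮ (f₂ , k₂) =
    f₁ + signed k₁ f₂ + ψ (f₁ , k₁ , k₂) + [ k₁ ] · ([ k₂ ] · y) , k₁ ℙ.+ k₂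

  0ᴮ : B
  0ᴮ = 0# , 0ℙ

  -ᴮ_ : B → B
  -ᴮ (f , 0ℙ) = - f , 0ℙ
  -ᴮ (f , 1ℙ) = f + y , 1ℙ

  _⁻¹ᴮ : B → B
  (f , 0ℙ) ⁻¹ᴮ = - f , 0ℙ
  (f , 1ℙ) ⁻¹ᴮ = f + (φ f - z) + y , 1ℙ

  open AbelianGroupProperties F using (ε⁻¹≈ε; ⁻¹-involutive; ⁻¹-∙-comm; inverseʳ-unique)
  open CommutativeMonoidSolver commutativeMonoid using (solve; _⊜_; _⊕_; id)
  open GroupHomomorphism endo
    using () renaming (homo to φ-homo; ε-homo to φ-0; ⁻¹-homo to φ-neg; ⟦⟧-cong to φ-cong)
  open SetoidReasoning setoid

  β : Parity → Parity → Carrier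
  β k₁ k₂ = [ k₁ ] · ([ k₂ ] · y)

  -y≈y : - y ≈ y
  -y≈y = sym (inverseʳ-unique y y 2y≈0)

  -‿+ : ∀ a b → - (a + b) ≈ - a + - b
  -‿+ a b = sym (⁻¹-∙-comm a b)

  -- Lets the commutative monoid solver, which ignores inverses, prove a ≈ b.
  drop : ∀ {a b} x → a ≈ b + (x + - x) → a ≈ b
  drop {a} {b} x eq = trans eq (trans (∙-congˡ (inverseʳ x)) (identityʳ b))

  ·-cong : ∀ k {a b} → a ≈ b → [ k ] · a ≈ [ k ] · b
  ·-cong 0ℙ eq = refl
  ·-cong 1ℙ eq = eq

  signed-cong : ∀ k {a b} → a ≈ b → signed k a ≈ signed k b
  signed-cong 0ℙ eq = eq
  signed-cong 1ℙ eq = ⁻¹-cong eq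

  signed-+ : ∀ k a b → signed k (a + b) ≈ signed k a + signed k b
  signed-+ 0ℙ a b = refl
  signed-+ 1ℙ a b = -‿+ a b

  signed-0 : ∀ k → signed k 0# ≈ 0#
  signed-0 0ℙ = refl
  signed-0 1ℙ = ε⁻¹≈ε

  signed-signed : ∀ k₁ k₂ f → signed k₁ (signed k₂ f) ≈ signed (k₁ ℙ.+ k₂) f
  signed-signed 0ℙ k₂ f = refl
  signed-signed 1ℙ 0ℙ f = refl
  signed-signed 1ℙ 1ℙ f = ⁻¹-involutive f

  signed-self : ∀ k f → signed k (signed k f) ≈ f
  signed-self 0ℙ f = refl
  signed-self 1ℙ f = ⁻¹-involutive f

  φ-signed : ∀ k f → φ (signed k f) ≈ signed k (φ f)
  φ-signed 0ℙ f = refl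
  φ-signed 1ℙ f = φ-neg f

  signed-β : ∀ k k₁ k₂ → signed k (β k₁ k₂) ≈ β k₁ k₂
  signed-β 0ℙ k₁ k₂ = refl
  signed-β 1ℙ 0ℙ k₂ = ε⁻¹≈ε
  signed-β 1ℙ 1ℙ 0ℙ = ε⁻¹≈ε
  signed-β 1ℙ 1ℙ 1ℙ = -y≈y

  β-cocycle : ∀ k₁ k₂ k₃ → β k₁ k₂ + β (k₁ ℙ.+ k₂) k₃ ≈ β k₂ k₃ + β k₁ (k₂ ℙ.+ k₃)
  β-cocycle 0ℙ k₂ k₃ = comm _ _
  β-cocycle 1ℙ 0ℙ k₃ = refl
  β-cocycle 1ℙ 1ℙ 0ℙ = comm _ _
  β-cocycle 1ℙ 1ℙ 1ℙ = refl

  ψ-cong : ∀ k₁ k₂ {f g} → f ≈ g → ψ (f , k₁ , k₂) ≈ ψ (g , k₁ , k₂)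
  ψ-cong k₁ k₂ eq = ·-cong k₂ (∙-congʳ (φ-cong eq))

  ≈ᴮ-isEquivalence : IsEquivalence _≈ᴮ_
  ≈ᴮ-isEquivalence = ×-isEquivalence isEquivalence ≡.isEquivalence

  setoidᴮ : Setoid c ℓ
  setoidᴮ = record { isEquivalence = ≈ᴮ-isEquivalence }

  rightInverse⇒isGroup : ∀ {_∙_ : B → B → B} {e inv} → IsMonoid _≈ᴮ_ _∙_ e →
    (∀ a → (a ∙ inv a) ≈ᴮ e) → (∀ {a b} → a ≈ᴮ b → inv a ≈ᴮ inv b) →
    IsGroup _≈ᴮ_ _∙_ e inv
  rightInverse⇒isGroup {_∙_} {e} {inv} M right inv-cong = record
    { isMonoid = M
    ; inverse  = left , right
    ; ⁻¹-cong  = inv-cong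
    }
    where
    module M = IsMonoid M
    module R = SetoidReasoning setoidᴮ
    left : ∀ a → (inv a ∙ a) ≈ᴮ e
    left a = R.begin
      inv a ∙ a                              R.≈⟨ M.identityʳ _ ⟨
      (inv a ∙ a) ∙ e                        R.≈⟨ M.∙-congˡ (right (inv a)) ⟨
      (inv a ∙ a) ∙ (inv a ∙ inv (inv a))    R.≈⟨ M.assoc _ _ _ ⟩
      inv a ∙ (a ∙ (inv a ∙ inv (inv a)))    R.≈⟨ M.∙-congˡ (M.assoc _ _ _) ⟨
      inv a ∙ ((a ∙ inv a) ∙ inv (inv a))    R.≈⟨ M.∙-congˡ (M.∙-congʳ (right a)) ⟩
      inv a ∙ (e ∙ inv (inv a))              R.≈⟨ M.∙-congˡ (M.identityˡ _) ⟩
      inv a ∙ inv (inv a)                    R.≈⟨ right (inv a) ⟩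
      e                                      R.∎

  lam⇒brace : ∀ {_∙_ _⊚_ l : B → B → B} {e inv} → IsGroup _≈ᴮ_ _∙_ e inv →
    (∀ a b → (a ⊚ b) ≈ᴮ (a ∙ l a b)) →
    (∀ a b c → l a (b ∙ c) ≈ᴮ (l a b ∙ l a c)) →
    ∀ a b c → (a ⊚ (b ∙ c)) ≈ᴮ (((a ⊚ b) ∙ inv a) ∙ (a ⊚ c))
  lam⇒brace {_∙_} {_⊚_} {l} {e} {inv} G ⊚≈ l-∙ a b c = R.begin
    a ⊚ (b ∙ c)                          R.≈⟨ ⊚≈ a (b ∙ c) ⟩
    a ∙ l a (b ∙ c)                      R.≈⟨ G.∙-congˡ (l-∙ a b c) ⟩
    a ∙ (l a b ∙ l a c)                  R.≈⟨ G.assoc _ _ _ ⟨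
    (a ∙ l a b) ∙ l a c                  R.≈⟨ G.∙-congʳ (⊚≈ a b) ⟨
    (a ⊚ b) ∙ l a c                      R.≈⟨ G.∙-congˡ (G.identityˡ _) ⟨
    (a ⊚ b) ∙ (e ∙ l a c)                R.≈⟨ G.∙-congˡ (G.∙-congʳ (G.inverseˡ a)) ⟨
    (a ⊚ b) ∙ ((inv a ∙ a) ∙ l a c)      R.≈⟨ G.∙-congˡ (G.assoc _ _ _) ⟩
    (a ⊚ b) ∙ (inv a ∙ (a ∙ l a c))      R.≈⟨ G.assoc _ _ _ ⟨
    ((a ⊚ b) ∙ inv a) ∙ (a ∙ l a c)      R.≈⟨ G.∙-congˡ (⊚≈ a c) ⟨
    ((a ⊚ b) ∙ inv a) ∙ (a ⊚ c)          R.∎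
    where
    module G = IsGroup G
    module R = SetoidReasoning setoidᴮ

  +ᴮ-cong : ∀ {a b a′ b′} → a ≈ᴮ a′ → b ≈ᴮ b′ → a +ᴮ b ≈ᴮ a′ +ᴮ b′
  +ᴮ-cong {_ , k₁} (p , ≡.refl) (q , ≡.refl) =
    ∙-congʳ (∙-cong p (signed-cong k₁ q)) , ≡.refl

  +ᴮ-assoc : ∀ a b c → (a +ᴮ b) +ᴮ c ≈ᴮ a +ᴮ (b +ᴮ c)
  +ᴮ-assoc (f₁ , k₁) (f₂ , k₂) (f₃ , k₃) = eq , ℙ.+-assoc k₁ k₂ k₃
    where
    eq : f₁ + signed k₁ f₂ + β k₁ k₂ + signed (k₁ ℙ.+ k₂) f₃ + β (k₁ ℙ.+ k₂) k₃
       ≈ f₁ + signed k₁ (f₂ + signed k₂ f₃ + β k₂ k₃) + β k₁ (k₂ ℙ.+ k₃)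
    eq = begin
      f₁ + signed k₁ f₂ + β k₁ k₂ + signed (k₁ ℙ.+ k₂) f₃ + β (k₁ ℙ.+ k₂) k₃
        ≈⟨ solve 5 (λ a b p q r → (((a ⊕ b) ⊕ p) ⊕ q) ⊕ r ⊜ (a ⊕ (b ⊕ q)) ⊕ (p ⊕ r))
             refl _ _ _ _ _ ⟩
      (f₁ + (signed k₁ f₂ + signed (k₁ ℙ.+ k₂) f₃)) + (β k₁ k₂ + β (k₁ ℙ.+ k₂) k₃)
        ≈⟨ ∙-cong (∙-congˡ (∙-congˡ (sym (signed-signed k₁ k₂ f₃)))) (β-cocycle k₁ k₂ k₃) ⟩
      (f₁ + (signed k₁ f₂ + signed k₁ (signed k₂ f₃))) + (β k₂ k₃ + β k₁ (k₂ ℙ.+ k₃))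
        ≈⟨ solve 5 (λ a b q p r → (a ⊕ (b ⊕ q)) ⊕ (p ⊕ r) ⊜ (a ⊕ ((b ⊕ q) ⊕ p)) ⊕ r)
             refl _ _ _ _ _ ⟩
      f₁ + (signed k₁ f₂ + signed k₁ (signed k₂ f₃) + β k₂ k₃) + β k₁ (k₂ ℙ.+ k₃)
        ≈⟨ ∙-congʳ (∙-congˡ (∙-cong (sym (signed-+ k₁ _ _)) (sym (signed-β k₁ k₂ k₃)))) ⟩
      f₁ + (signed k₁ (f₂ + signed k₂ f₃) + signed k₁ (β k₂ k₃)) + β k₁ (k₂ ℙ.+ k₃)
        ≈⟨ ∙-congʳ (∙-congˡ (sym (signed-+ k₁ _ _))) ⟩
      f₁ + signed k₁ (f₂ + signed k₂ f₃ + β k₂ k₃) + β k₁ (k₂ ℙ.+ k₃) ∎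

  +ᴮ-identityˡ : ∀ a → 0ᴮ +ᴮ a ≈ᴮ a
  +ᴮ-identityˡ (f , k) = trans (identityʳ _) (identityˡ f) , ≡.refl

  β-0ʳ : ∀ k → β k 0ℙ ≈ 0#
  β-0ʳ 0ℙ = refl
  β-0ʳ 1ℙ = refl

  +ᴮ-identityʳ : ∀ a → a +ᴮ 0ᴮ ≈ᴮ a
  +ᴮ-identityʳ (f , k) =
    trans (∙-cong (trans (∙-congˡ (signed-0 k)) (identityʳ f)) (β-0ʳ k)) (identityʳ f)
    , ℙ.+-identityʳ k

  +ᴮ-inverseʳ : ∀ a → a +ᴮ (-ᴮ a) ≈ᴮ 0ᴮ
  +ᴮ-inverseʳ (f , 0ℙ) = trans (identityʳ _) (inverseʳ f) , ≡.refl
  +ᴮ-inverseʳ (f , 1ℙ) = drop f (drop y (trans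
      (∙-congʳ (∙-congˡ (-‿+ f y)))
      (solve 4 (λ f f′ y y′ → (f ⊕ (f′ ⊕ y′)) ⊕ y ⊜ (id ⊕ (f ⊕ f′)) ⊕ (y ⊕ y′)) refl _ _ _ _)))
    , ≡.refl

  -ᴮ-cong : ∀ {a b} → a ≈ᴮ b → -ᴮ a ≈ᴮ -ᴮ b
  -ᴮ-cong {_ , 0ℙ} (p , ≡.refl) = ⁻¹-cong p , ≡.refl
  -ᴮ-cong {_ , 1ℙ} (p , ≡.refl) = ∙-congʳ p , ≡.refl

  +ᴮ-isGroup : IsGroup _≈ᴮ_ _+ᴮ_ 0ᴮ -ᴮ_
  +ᴮ-isGroup = rightInverse⇒isGroup
    (record
      { isSemigroup = record
        { isMagma = record { isEquivalence = ≈ᴮ-isEquivalence ; ∙-cong = +ᴮ-cong }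
        ; assoc   = +ᴮ-assoc
        }
      ; identity = +ᴮ-identityˡ , +ᴮ-identityʳ
      })
    +ᴮ-inverseʳ -ᴮ-cong

  ∘ᴮ-cong : ∀ {a b a′ b′} → a ≈ᴮ a′ → b ≈ᴮ b′ → a ∘ᴮ b ≈ᴮ a′ ∘ᴮ b′
  ∘ᴮ-cong {_ , k₁} {_ , k₂} (p , ≡.refl) (q , ≡.refl) =
    ∙-congʳ (∙-cong (∙-cong p (signed-cong k₁ q)) (ψ-cong k₁ k₂ p)) , ≡.refl

  φ-· : ∀ k f → φ ([ k ] · f) ≈ [ k ] · φ f
  φ-· 0ℙ f = φ-0
  φ-· 1ℙ f = refl

  z-term : ∀ k → [ k ] · φ y + - ([ k ] · φ z) + - ([ k ℙ.+ 1ℙ ] · z) + - ([ k ] · z)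
               ≈ signed k (- z)
  z-term 0ℙ = begin
    0# + - 0# + - z + - 0# ≈⟨ ∙-cong (∙-congʳ (inverseʳ 0#)) ε⁻¹≈ε ⟩
    0# + - z + 0#          ≈⟨ trans (identityʳ _) (identityˡ _) ⟩
    - z                    ∎
  z-term 1ℙ = begin
    φ y + - φ z + - 0# + - z
      ≈⟨ ∙-congʳ (∙-cong (∙-congˡ (trans (⁻¹-cong φz≈φy-2z)
           (trans (-‿+ _ _) (∙-congˡ (⁻¹-involutive _))))) ε⁻¹≈ε) ⟩
    φ y + (- φ y + (z + z)) + 0# + - z
      ≈⟨ drop (φ y) (drop z (solve 4 (λ a b z c →
           ((a ⊕ (b ⊕ (z ⊕ z))) ⊕ id) ⊕ c ⊜ (z ⊕ (a ⊕ b)) ⊕ (z ⊕ c)) refl _ _ _ _)) ⟩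
    z
      ≈⟨ ⁻¹-involutive z ⟨
    - (- z) ∎

  φ-step : ∀ f₁ f₂ k → φ (f₁ + signed k f₂ + (φ f₁ - [ k ] · z) + [ k ] · y)
         ≈ φ f₁ + signed k (φ f₂) + (- φ f₁ + - φ f₁ + - ([ k ] · φ z)) + [ k ] · φ y
  φ-step f₁ f₂ k = trans (φ-homo _ _) (∙-cong
    (trans (φ-homo _ _) (∙-cong
      (trans (φ-homo _ _) (∙-congˡ (φ-signed k f₂)))
      (trans (φ-homo _ _) (∙-cong
        (trans (φφ≈-2φ f₁) (-‿+ _ _))
        (trans (φ-neg _) (⁻¹-cong (φ-· k z)))))))
    (φ-· k y))

  ψ-cocycle : ∀ f₁ f₂ k₁ k₂ k₃ →
    ψ (f₁ , k₁ , k₂) + ψ (f₁ + signed k₁ f₂ + ψ (f₁ , k₁ , k₂) + β k₁ k₂ , k₁ ℙ.+ k₂ , k₃)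
    ≈ signed k₁ (ψ (f₂ , k₂ , k₃)) + ψ (f₁ , k₁ , k₂ ℙ.+ k₃)
  ψ-cocycle f₁ f₂ k₁ 0ℙ 0ℙ = ∙-congʳ (sym (signed-0 k₁))
  ψ-cocycle f₁ f₂ k₁ 1ℙ 0ℙ = trans (comm _ _) (∙-congʳ (sym (signed-0 k₁)))
  ψ-cocycle f₁ f₂ k₁ 0ℙ 1ℙ rewrite ℙ.+-identityʳ k₁ = begin
    0# + (φ (f₁ + signed k₁ f₂ + 0# + β k₁ 0ℙ) + - ([ k₁ ] · z))
      ≈⟨ identityˡ _ ⟩
    φ (f₁ + signed k₁ f₂ + 0# + β k₁ 0ℙ) + - ([ k₁ ] · z)
      ≈⟨ ∙-congʳ (φ-cong (trans (∙-cong (identityʳ _) (β-0ʳ k₁)) (identityʳ _))) ⟩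
    φ (f₁ + signed k₁ f₂) + - ([ k₁ ] · z)
      ≈⟨ ∙-congʳ (trans (φ-homo _ _) (∙-congˡ (φ-signed k₁ f₂))) ⟩
    φ f₁ + signed k₁ (φ f₂) + - ([ k₁ ] · z)
      ≈⟨ solve 3 (λ a b c → (a ⊕ b) ⊕ c ⊜ b ⊕ (a ⊕ c)) refl _ _ _ ⟩
    signed k₁ (φ f₂) + (φ f₁ + - ([ k₁ ] · z))
      ≈⟨ ∙-congʳ (signed-cong k₁ (trans (∙-congˡ ε⁻¹≈ε) (identityʳ _))) ⟨
    signed k₁ (φ f₂ + - 0#) + (φ f₁ + - ([ k₁ ] · z)) ∎
  ψ-cocycle f₁ f₂ k₁ 1ℙ 1ℙ = begin
    φ f₁ + - ([ k₁ ] · z)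
      + (φ (f₁ + signed k₁ f₂ + (φ f₁ + - ([ k₁ ] · z)) + [ k₁ ] · y) + - ([ k₁ ℙ.+ 1ℙ ] · z))
      ≈⟨ ∙-congˡ (∙-congʳ (φ-step f₁ f₂ k₁)) ⟩
    φ f₁ + - ([ k₁ ] · z)
      + (φ f₁ + signed k₁ (φ f₂) + (- φ f₁ + - φ f₁ + - ([ k₁ ] · φ z)) + [ k₁ ] · φ y
         + - ([ k₁ ℙ.+ 1ℙ ] · z))
      ≈⟨ drop (φ f₁) (drop (φ f₁) (solve 7 (λ p q s p′ t u v →
           (p ⊕ q) ⊕ ((((p ⊕ s) ⊕ ((p′ ⊕ p′) ⊕ t)) ⊕ u) ⊕ v)
           ⊜ ((s ⊕ (((u ⊕ t) ⊕ v) ⊕ q)) ⊕ (p ⊕ p′)) ⊕ (p ⊕ p′)) refl _ _ _ _ _ _ _)) ⟩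
    signed k₁ (φ f₂)
      + ([ k₁ ] · φ y + - ([ k₁ ] · φ z) + - ([ k₁ ℙ.+ 1ℙ ] · z) + - ([ k₁ ] · z))
      ≈⟨ ∙-congˡ (z-term k₁) ⟩
    signed k₁ (φ f₂) + signed k₁ (- z)
      ≈⟨ signed-+ k₁ _ _ ⟨
    signed k₁ (φ f₂ + - z)
      ≈⟨ identityʳ _ ⟨
    signed k₁ (φ f₂ + - z) + 0# ∎

  ∘ᴮ-assoc : ∀ a b c → (a ∘ᴮ b) ∘ᴮ c ≈ᴮ a ∘ᴮ (b ∘ᴮ c)
  ∘ᴮ-assoc (f₁ , k₁) (f₂ , k₂) (f₃ , k₃) = eq , ℙ.+-assoc k₁ k₂ k₃
    where
    g₁₂ g₂₃ : Carrier
    g₁₂ = f₁ + signed k₁ f₂ + ψ (f₁ , k₁ , k₂) + β k₁ k₂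
    g₂₃ = f₂ + signed k₂ f₃ + ψ (f₂ , k₂ , k₃) + β k₂ k₃
    eq : g₁₂ + signed (k₁ ℙ.+ k₂) f₃ + ψ (g₁₂ , k₁ ℙ.+ k₂ , k₃) + β (k₁ ℙ.+ k₂) k₃
       ≈ f₁ + signed k₁ g₂₃ + ψ (f₁ , k₁ , k₂ ℙ.+ k₃) + β k₁ (k₂ ℙ.+ k₃)
    eq = begin
      g₁₂ + signed (k₁ ℙ.+ k₂) f₃ + ψ (g₁₂ , k₁ ℙ.+ k₂ , k₃) + β (k₁ ℙ.+ k₂) k₃
        ≈⟨ solve 7 (λ a b w p q w′ r →
             (((((a ⊕ b) ⊕ w) ⊕ p) ⊕ q) ⊕ w′) ⊕ r
             ⊜ ((a ⊕ (b ⊕ q)) ⊕ (w ⊕ w′)) ⊕ (p ⊕ r)) refl _ _ _ _ _ _ _ ⟩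
      f₁ + (signed k₁ f₂ + signed (k₁ ℙ.+ k₂) f₃)
        + (ψ (f₁ , k₁ , k₂) + ψ (g₁₂ , k₁ ℙ.+ k₂ , k₃))
        + (β k₁ k₂ + β (k₁ ℙ.+ k₂) k₃)
        ≈⟨ ∙-cong (∙-cong (∙-congˡ (∙-congˡ (sym (signed-signed k₁ k₂ f₃))))
             (ψ-cocycle f₁ f₂ k₁ k₂ k₃))
             (trans (β-cocycle k₁ k₂ k₃) (∙-congʳ (sym (signed-β k₁ k₂ k₃)))) ⟩
      f₁ + (signed k₁ f₂ + signed k₁ (signed k₂ f₃))
        + (signed k₁ (ψ (f₂ , k₂ , k₃)) + ψ (f₁ , k₁ , k₂ ℙ.+ k₃))
        + (signed k₁ (β k₂ k₃) + β k₁ (k₂ ℙ.+ k₃))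
        ≈⟨ solve 7 (λ a b q w w′ p r →
             ((a ⊕ (b ⊕ q)) ⊕ (w ⊕ w′)) ⊕ (p ⊕ r)
             ⊜ ((a ⊕ (((b ⊕ q) ⊕ w) ⊕ p)) ⊕ w′) ⊕ r) refl _ _ _ _ _ _ _ ⟩
      f₁ + (signed k₁ f₂ + signed k₁ (signed k₂ f₃) + signed k₁ (ψ (f₂ , k₂ , k₃))
        + signed k₁ (β k₂ k₃)) + ψ (f₁ , k₁ , k₂ ℙ.+ k₃) + β k₁ (k₂ ℙ.+ k₃)
        ≈⟨ ∙-congʳ (∙-congʳ (∙-congˡ (trans (signed-+ k₁ _ _) (∙-congʳ
             (trans (signed-+ k₁ _ _) (∙-congʳ (signed-+ k₁ _ _))))))) ⟨
      f₁ + signed k₁ g₂₃ + ψ (f₁ , k₁ , k₂ ℙ.+ k₃) + β k₁ (k₂ ℙ.+ k₃) ∎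

  φ0-0≈0 : φ 0# + - 0# ≈ 0#
  φ0-0≈0 = trans (∙-congʳ φ-0) (inverseʳ 0#)

  ψ-0ˡ : ∀ k → ψ (0# , 0ℙ , k) ≈ 0#
  ψ-0ˡ 0ℙ = refl
  ψ-0ˡ 1ℙ = φ0-0≈0

  ∘ᴮ-identityˡ : ∀ a → 0ᴮ ∘ᴮ a ≈ᴮ a
  ∘ᴮ-identityˡ (f , k) =
    trans (identityʳ _) (trans (∙-cong (identityˡ f) (ψ-0ˡ k)) (identityʳ f)) , ≡.refl

  ∘ᴮ-identityʳ : ∀ a → a ∘ᴮ 0ᴮ ≈ᴮ a
  ∘ᴮ-identityʳ (f , k) =
    trans (∙-cong (trans (identityʳ _) (trans (∙-congˡ (signed-0 k)) (identityʳ f))) (β-0ʳ k))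
          (identityʳ f)
    , ℙ.+-identityʳ k

  ∘ᴮ-inverseʳ : ∀ a → a ∘ᴮ (a ⁻¹ᴮ) ≈ᴮ 0ᴮ
  ∘ᴮ-inverseʳ (f , 0ℙ) = trans (identityʳ _) (trans (identityʳ _) (inverseʳ f)) , ≡.refl
  ∘ᴮ-inverseʳ (f , 1ℙ) = drop f (drop w (drop y (trans
      (∙-congʳ (∙-congʳ (∙-congˡ (trans (-‿+ _ _) (∙-congʳ (-‿+ _ _))))))
      (solve 6 (λ f f′ w w′ y y′ →
        ((f ⊕ ((f′ ⊕ w′) ⊕ y′)) ⊕ w) ⊕ y
        ⊜ ((id ⊕ (f ⊕ f′)) ⊕ (w ⊕ w′)) ⊕ (y ⊕ y′)) refl _ _ _ _ _ _))))
    , ≡.refl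
    where
    w : Carrier
    w = φ f - z

  ⁻¹ᴮ-cong : ∀ {a b} → a ≈ᴮ b → a ⁻¹ᴮ ≈ᴮ b ⁻¹ᴮ
  ⁻¹ᴮ-cong {_ , 0ℙ} (p , ≡.refl) = ⁻¹-cong p , ≡.refl
  ⁻¹ᴮ-cong {_ , 1ℙ} (p , ≡.refl) = ∙-congʳ (∙-cong p (∙-congʳ (φ-cong p))) , ≡.refl

  ∘ᴮ-isGroup : IsGroup _≈ᴮ_ _∘ᴮ_ 0ᴮ _⁻¹ᴮ
  ∘ᴮ-isGroup = rightInverse⇒isGroup
    (record
      { isSemigroup = record
        { isMagma = record { isEquivalence = ≈ᴮ-isEquivalence ; ∙-cong = ∘ᴮ-cong }
        ; assoc   = ∘ᴮ-assoc
        }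
      ; identity = ∘ᴮ-identityˡ , ∘ᴮ-identityʳ
      })
    ∘ᴮ-inverseʳ ⁻¹ᴮ-cong

  -- The map b ↦ - a + a ∘ b.
  lam : B → B → B
  lam (f₁ , k₁) (f₂ , k₂) = f₂ + signed k₁ (ψ (f₁ , k₁ , k₂)) , k₂

  ∘ᴮ≈+ᴮ-lam : ∀ a b → a ∘ᴮ b ≈ᴮ a +ᴮ lam a b
  ∘ᴮ≈+ᴮ-lam (f₁ , k₁) (f₂ , k₂) = ∙-congʳ (begin
    f₁ + signed k₁ f₂ + ψ (f₁ , k₁ , k₂)
      ≈⟨ assoc _ _ _ ⟩
    f₁ + (signed k₁ f₂ + ψ (f₁ , k₁ , k₂))
      ≈⟨ ∙-congˡ (∙-congˡ (signed-self k₁ _)) ⟨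
    f₁ + (signed k₁ f₂ + signed k₁ (signed k₁ (ψ (f₁ , k₁ , k₂))))
      ≈⟨ ∙-congˡ (signed-+ k₁ _ _) ⟨
    f₁ + signed k₁ (f₂ + signed k₁ (ψ (f₁ , k₁ , k₂))) ∎) , ≡.refl

  signed-ψ-+ : ∀ f k₁ k₂ k₃ → signed k₁ (ψ (f , k₁ , k₂ ℙ.+ k₃))
    ≈ signed k₁ (ψ (f , k₁ , k₂)) + signed k₂ (signed k₁ (ψ (f , k₁ , k₃)))
  signed-ψ-+ f k₁ 0ℙ k₃ = sym (trans (∙-congʳ (signed-0 k₁)) (identityˡ _))
  signed-ψ-+ f k₁ 1ℙ 0ℙ =
    sym (trans (∙-congˡ (trans (⁻¹-cong (signed-0 k₁)) ε⁻¹≈ε)) (identityʳ _))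
  signed-ψ-+ f k₁ 1ℙ 1ℙ = trans (signed-0 k₁) (sym (inverseʳ _))

  lam-+ : ∀ a b c → lam a (b +ᴮ c) ≈ᴮ lam a b +ᴮ lam a c
  lam-+ (f₁ , k₁) (f₂ , k₂) (f₃ , k₃) = (begin
    f₂ + signed k₂ f₃ + β k₂ k₃ + signed k₁ (ψ (f₁ , k₁ , k₂ ℙ.+ k₃))
      ≈⟨ ∙-congˡ (signed-ψ-+ f₁ k₁ k₂ k₃) ⟩
    f₂ + signed k₂ f₃ + β k₂ k₃
      + (signed k₁ (ψ (f₁ , k₁ , k₂)) + signed k₂ (signed k₁ (ψ (f₁ , k₁ , k₃))))
      ≈⟨ solve 5 (λ a b p u v →
           ((a ⊕ b) ⊕ p) ⊕ (u ⊕ v) ⊜ ((a ⊕ u) ⊕ (b ⊕ v)) ⊕ p) refl _ _ _ _ _ ⟩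
    f₂ + signed k₁ (ψ (f₁ , k₁ , k₂))
      + (signed k₂ f₃ + signed k₂ (signed k₁ (ψ (f₁ , k₁ , k₃)))) + β k₂ k₃
      ≈⟨ ∙-congʳ (∙-congˡ (signed-+ k₂ _ _)) ⟨
    f₂ + signed k₁ (ψ (f₁ , k₁ , k₂))
      + signed k₂ (f₃ + signed k₁ (ψ (f₁ , k₁ , k₃))) + β k₂ k₃ ∎) , ≡.refl

  ∘ᴮ-brace : ∀ a b c → a ∘ᴮ (b +ᴮ c) ≈ᴮ (a ∘ᴮ b +ᴮ (-ᴮ a)) +ᴮ (a ∘ᴮ c)
  ∘ᴮ-brace = lam⇒brace +ᴮ-isGroup ∘ᴮ≈+ᴮ-lam lam-+

  skewBrace : SkewBrace c ℓ
  skewBrace = record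
    { Carrier   = B
    ; _≈_       = _≈ᴮ_
    ; _+_       = _+ᴮ_
    ; 0#        = 0ᴮ
    ; -_        = -ᴮ_
    ; _∘_       = _∘ᴮ_
    ; 1#        = 0ᴮ
    ; _⁻¹       = _⁻¹ᴮ
    ; +-isGroup = +ᴮ-isGroup
    ; ∘-isGroup = ∘ᴮ-isGroup
    ; ∘-brace   = ∘ᴮ-brace
    }

open Construction public using (skewBrace)

{-# OPTIONS --safe #-}

-- In the skew brace of (φ , y , z), the elements a * b = - a + a ∘ b - b are
-- exactly those of F × {0}, because ψ is surjective.  Hence an isomorphism θ
-- restricts to an automorphism σ of F, and θ (0 , 1) = (c , 1) for some c.
-- Applying θ to (0 , 1) + (0 , 1), (f , 0) ∘ (0 , 1) and (0 , 1) ∘ (0 , 1) gives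
-- σ y = y₁, σ φ = φ₁ σ and φ₁ c = z₁ - σ z.  Conversely, such σ and c define the
-- isomorphism (f , k) ↦ (σ f + [ k ] c , k).
module Submission where

open import Defs
open import Algebra.Bundles using (AbelianGroup; Group)
open import Algebra.Morphism.Bundles using (GroupHomomorphism)
open import Algebra.Morphism.Definitions using (Homomorphic₂)
open import Algebra.Morphism.Structures using (IsGroupHomomorphism)
import Algebra.Definitions.RawMonoid as RawMonoidDefinitions
import Algebra.Properties.AbelianGroup as AbelianGroupProperties
import Algebra.Properties.Group as GroupProperties
import Algebra.Solver.CommutativeMonoid as CommutativeMonoidSolver
open import Data.Parity.Base as ℙ using (Parity; 0ℙ; 1ℙ)
import Data.Parity.Properties as ℙ
open import Data.Product.Base using (Σ-syntax; ∃-syntax; _×_; _,_; proj₁; proj₂)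
open import Function.Bundles using (_⇔_; mk⇔)
import Function.Consequences.Setoid as Consequences
open import Function.Definitions using (Congruent; Injective; StrictlySurjective)
open import Level using (_⊔_)
open import Relation.Binary.Bundles using (Setoid)
open import Relation.Binary.PropositionalEquality as ≡ using (_≡_)
import Relation.Binary.Reasoning.Setoid as SetoidReasoning
open import Relation.Nullary.Negation.Core using (¬_)
open AdmissibleData using (φ; y; z)
open Automorphism using (⟦_⟧; ⟦_⟧⁻¹)

-- Homomorphisms between groups.

module _ {a b ℓ₁ ℓ₂} (G : Group a ℓ₁) (H : Group b ℓ₂) where
  private
    module G = Group G
    module H = Group H
  open GroupProperties H using (identityˡ-unique; inverseˡ-unique)

  -- The element `h ε` is idempotent, hence trivial, and then the image of an inverse is a left
  -- inverse of the image. Afterwards only binary operations have to be checked.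
  homomorphic₂⇒isGroupHomomorphism : ∀ {h} → Congruent G._≈_ H._≈_ h →
    Homomorphic₂ G.Carrier H.Carrier H._≈_ h G._∙_ H._∙_ →
    IsGroupHomomorphism G.rawGroup H.rawGroup h
  homomorphic₂⇒isGroupHomomorphism {h} h-cong h-homo = record
    { isMonoidHomomorphism = record
      { isMagmaHomomorphism = record
        { isRelHomomorphism = record { cong = h-cong }
        ; homo              = h-homo
        }
      ; ε-homo = ε-homo
      }
    ; ⁻¹-homo = λ x → inverseˡ-unique _ _
        (H.trans (H.sym (h-homo _ _)) (H.trans (h-cong (G.inverseˡ x)) ε-homo))
    }
    where
    ε-homo : h G.ε H.≈ H.ε
    ε-homo = identityˡ-unique _ _
      (H.trans (H.sym (h-homo _ _)) (h-cong (G.identityˡ G.ε)))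

module _ {c ℓ} (F : AbelianGroup c ℓ) where
  open AbelianGroup F renaming (_∙_ to infixl 6 _+_; ε to 0#; _⁻¹ to -_)
  open RawMonoidDefinitions rawMonoid using () renaming (_×′_ to infixl 8 _·_)
  open AbelianGroupProperties F
    using (ε⁻¹≈ε; ⁻¹-involutive; ∙-cancelʳ; xyx⁻¹≈y; //-rightDividesˡ)
  open CommutativeMonoidSolver commutativeMonoid using (solve; _⊜_; _⊕_)
  open SetoidReasoning setoid

  -- The subset `F × {0}` and the uniqueness of the parity map.

  module _ (d : AdmissibleData F) where
    open Construction F d
    open AdmissibleData d using (ψ; ψ-surjective)
    open GroupHomomorphism (AdmissibleData.endo d) using () renaming (⁻¹-homo to φ-neg)
    private module ≈ᴮ = Setoid setoidᴮ

    -- Surjectivity of `ψ` is used at `- g`. If `k₁` is `1ℙ`, the sign undoes the minus. If `k₁` is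
    -- `0ℙ`, there is no sign, but the `z` term vanishes too, so a nonzero value of `ψ` is negated
    -- by passing from `f` to `- f`.
    signed-ψ-surjective : ∀ g → ∃[ f ] ∃[ k₁ ] ∃[ k₂ ] signed k₁ (ψ (f , k₁ , k₂)) ≈ g
    signed-ψ-surjective g with ψ-surjective (- g)
    ... | (f , 1ℙ , k₂) , eq = f , 1ℙ , k₂ , trans (⁻¹-cong eq) (⁻¹-involutive g)
    ... | (f , 0ℙ , 0ℙ) , eq =
      f , 0ℙ , 0ℙ , trans (sym ε⁻¹≈ε) (trans (⁻¹-cong eq) (⁻¹-involutive g))
    ... | (f , 0ℙ , 1ℙ) , eq = - f , 0ℙ , 1ℙ , (begin
      φ d (- f) - 0#    ≈⟨ ∙-cong (φ-neg f) ε⁻¹≈ε ⟩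
      - φ d f + 0#      ≈⟨ identityʳ _ ⟩
      - φ d f           ≈⟨ ⁻¹-cong (trans (∙-congˡ ε⁻¹≈ε) (identityʳ _)) ⟨
      - (φ d f - 0#)    ≈⟨ ⁻¹-cong eq ⟩
      - (- g)           ≈⟨ ⁻¹-involutive g ⟩
      g                 ∎)

    -- This says a * b ≈ (g , 0ℙ), with - a and - b moved to the other side so that
    -- a homomorphism into Parity can be applied to it directly.
    F×0⊆B*B : ∀ g → ∃[ a ] ∃[ b ] a ∘ᴮ b ≈ᴮ a +ᴮ ((g , 0ℙ) +ᴮ b)
    F×0⊆B*B g with signed-ψ-surjective g
    ... | f , k₁ , k₂ , eq = (f , k₁) , (0# , k₂) ,
      ≈ᴮ.trans (∘ᴮ≈+ᴮ-lam (f , k₁) (0# , k₂))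
        (+ᴮ-cong {f , k₁} {lam (f , k₁) (0# , k₂)} ≈ᴮ.refl
          (trans (comm 0# _) (trans (∙-congʳ eq) (sym (identityʳ _))) , ≡.refl))

    F×0+0×k : ∀ f k → (f , 0ℙ) +ᴮ (0# , k) ≈ᴮ (f , k)
    F×0+0×k f k = trans (identityʳ _) (identityʳ f) , ≡.refl

    module _ {p : B → Parity} (p-cong : Congruent _≈ᴮ_ _≡_ p)
      (p-+ : Homomorphic₂ B Parity _≡_ p _+ᴮ_ ℙ._+_)
      (p-∘ : Homomorphic₂ B Parity _≡_ p _∘ᴮ_ ℙ._+_) where

      -- Since `p` carries both operations to the same one, writing `(g , 0ℙ)` as `a * b` makes
      -- `p a` and `p b` cancel.
      parity-trivial-on-F×0 : ∀ g → p (g , 0ℙ) ≡ 0ℙ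
      parity-trivial-on-F×0 g with F×0⊆B*B g
      ... | a , b , a∘b≈a+g+b =
        ≡.sym (ℙ.+-cancelʳ-≡ (p b) _ _ (ℙ.+-cancelˡ-≡ (p a) _ _
          (≡.trans (≡.sym (p-∘ a b)) (≡.trans (p-cong a∘b≈a+g+b)
            (≡.trans (p-+ a _) (≡.cong (p a ℙ.+_) (p-+ _ b)))))))

      -- By triviality on `F × {0}`, `p` depends only on the second component; to reach `1ℙ` it must
      -- take that value on `(0# , 1ℙ)`.
      parity-unique : StrictlySurjective _≡_ p → ∀ b → p b ≡ proj₂ b
      parity-unique p-surj (f , 0ℙ) = parity-trivial-on-F×0 f
      parity-unique p-surj (f , 1ℙ) = ≡.trans (p[f,1]≡p[0,1] f) p[0,1]≡1
        where
        p[f,1]≡p[0,1] : ∀ f → p (f , 1ℙ) ≡ p (0# , 1ℙ)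
        p[f,1]≡p[0,1] f = ≡.trans (p-cong (≈ᴮ.sym (F×0+0×k f 1ℙ)))
          (≡.trans (p-+ _ _) (≡.cong (ℙ._+ p (0# , 1ℙ)) (parity-trivial-on-F×0 f)))

        p[0,1]≡1 : p (0# , 1ℙ) ≡ 1ℙ
        p[0,1]≡1 with p-surj 1ℙ
        ... | (g , 1ℙ) , eq = ≡.trans (≡.sym (p[f,1]≡p[0,1] g)) eq
        ... | (g , 0ℙ) , eq with () ← ≡.trans (≡.sym (parity-trivial-on-F×0 g)) eq

  module _ (d d₁ : AdmissibleData F) where
    private
      module A = Construction F d
      module A₁ = Construction F d₁
      module ≈ᴮ = Setoid A₁.setoidᴮ
      module φ = GroupHomomorphism (AdmissibleData.endo d)
      module φ₁ = GroupHomomorphism (AdmissibleData.endo d₁)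
    open AdmissibleData d using (ψ)
    open AdmissibleData d₁ using () renaming (ψ to ψ₁)
    open A₁ using () renaming (_≈ᴮ_ to _≈₁_; _+ᴮ_ to _+₁_; _∘ᴮ_ to _∘₁_)

    Conjugates : Automorphism F → Set (c ⊔ ℓ)
    Conjugates σ =
      (∀ f → φ d₁ f ≈ ⟦ σ ⟧ (φ d (⟦ σ ⟧⁻¹ f)))
      × ⟦ σ ⟧ (y d) ≈ y d₁
      × (∃[ f ] φ d₁ f ≈ z d₁ - ⟦ σ ⟧ (z d))

    -- From an isomorphism of skew braces to an automorphism of `F`.

    module Restriction {θ : A.B → A₁.B}
      (θ-iso : IsSkewBraceIsomorphism (skewBrace F d) (skewBrace F d₁) θ) where
      open IsSkewBraceIsomorphism θ-iso
      open IsGroupHomomorphism +-isGroupHomomorphism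
        using () renaming (⟦⟧-cong to θ-cong; homo to θ-+)
      open IsGroupHomomorphism ∘-isGroupHomomorphism using () renaming (homo to θ-∘)

      θ-surjective : StrictlySurjective _≈₁_ θ
      θ-surjective = Consequences.surjective⇒strictlySurjective
        A.setoidᴮ A₁.setoidᴮ (proj₂ bijective)

      -- Following `θ` by the second projection gives a surjection onto `Parity` that respects both
      -- operations, so uniqueness applies.
      θ-parity : ∀ b → proj₂ (θ b) ≡ proj₂ b
      θ-parity = parity-unique d
        (λ eq → proj₂ (θ-cong eq)) (λ a b → proj₂ (θ-+ a b)) (λ a b → proj₂ (θ-∘ a b))
        (λ k → let b , eq = θ-surjective (0# , k) in b , proj₂ eq)

      s : Carrier → Carrier
      s f = proj₁ (θ (f , 0ℙ))

      c₁ : Carrier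
      c₁ = proj₁ (θ (0# , 1ℙ))

      θ-F : ∀ f → θ (f , 0ℙ) ≈₁ (s f , 0ℙ)
      θ-F f = refl , θ-parity (f , 0ℙ)

      θ-0×1 : θ (0# , 1ℙ) ≈₁ (c₁ , 1ℙ)
      θ-0×1 = refl , θ-parity (0# , 1ℙ)

      -- Comes from `(f , 1ℙ) = (f , 0ℙ) + (0# , 1ℙ)`; thus `s` and `c₁` determine `θ`.
      θ-f×1 : ∀ f → proj₁ (θ (f , 1ℙ)) ≈ s f + c₁
      θ-f×1 f = trans (proj₁ (≈ᴮ.trans (θ-cong (Setoid.sym A.setoidᴮ (F×0+0×k d f 1ℙ)))
        (≈ᴮ.trans (θ-+ _ _) (A₁.+ᴮ-cong (θ-F f) θ-0×1)))) (identityʳ _)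

      s-cong : Congruent _≈_ _≈_ s
      s-cong eq = proj₁ (θ-cong (eq , ≡.refl))

      s-homo : Homomorphic₂ Carrier Carrier _≈_ s _+_ _+_
      s-homo f g = begin
        s (f + g)       ≈⟨ s-cong (identityʳ _) ⟨
        s (f + g + 0#)  ≈⟨ proj₁ (≈ᴮ.trans (θ-+ _ _) (A₁.+ᴮ-cong (θ-F f) (θ-F g))) ⟩
        s f + s g + 0#  ≈⟨ identityʳ _ ⟩
        s f + s g       ∎

      s-injective : Injective _≈_ _≈_ s
      s-injective {f} {g} eq = proj₁ (proj₁ bijective
        (≈ᴮ.trans (θ-F f) (≈ᴮ.trans (eq , ≡.refl) (≈ᴮ.sym (θ-F g)))))

      s-surjective : StrictlySurjective _≈_ s
      s-surjective g with θ-surjective (g , 0ℙ)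
      ... | (f , 0ℙ) , eq = f , proj₁ eq
      ... | (f , 1ℙ) , eq with () ← ≡.trans (≡.sym (θ-parity (f , 1ℙ))) (proj₂ eq)

      s-isGroupHomomorphism : IsGroupHomomorphism rawGroup rawGroup s
      s-isGroupHomomorphism = homomorphic₂⇒isGroupHomomorphism group group s-cong s-homo

      open IsGroupHomomorphism s-isGroupHomomorphism using () renaming (⁻¹-homo to s-neg)

      restriction : Automorphism F
      restriction = record
        { ⟦_⟧                = s
        ; isGroupIsomorphism = record
          { isGroupMonomorphism = record
            { isGroupHomomorphism = s-isGroupHomomorphism
            ; injective           = s-injective
            }
          ; surjective = Consequences.strictlySurjective⇒surjective
              setoid setoid s-cong s-surjective
          }
        }

      -0#+x≈x : ∀ x → - 0# + x ≈ x
      -0#+x≈x x = trans (∙-congʳ ε⁻¹≈ε) (identityˡ x)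

      s-y : s (y d) ≈ y d₁
      s-y = begin
        -- The term `0# - 0# + y d` is the unreduced first component of `(0# , 1ℙ) + (0# , 1ℙ)`.
        s (y d)             ≈⟨ s-cong (trans (assoc _ _ _) (trans (identityˡ _) (-0#+x≈x _))) ⟨
        s (0# - 0# + y d)   ≈⟨ proj₁ (≈ᴮ.trans (θ-+ _ _) (A₁.+ᴮ-cong θ-0×1 θ-0×1)) ⟩
        c₁ - c₁ + y d₁      ≈⟨ ∙-congʳ (inverseʳ c₁) ⟩
        0# + y d₁           ≈⟨ identityˡ _ ⟩
        y d₁                ∎

      -- Both sides of `θ ((f , 0ℙ) ∘ (0# , 1ℙ))` are computed; the product has first component
      -- `φ d f + f` and parity `1ℙ`, and the common summand `s f + c₁` cancels.
      s-φ : ∀ f → s (φ d f) ≈ φ d₁ (s f)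
      s-φ f = ∙-cancelʳ (s f + c₁) _ _ (begin
        s (φ d f) + (s f + c₁)              ≈⟨ assoc _ _ _ ⟨
        s (φ d f) + s f + c₁                ≈⟨ ∙-congʳ (s-homo _ _) ⟨
        s (φ d f + f) + c₁                  ≈⟨ θ-f×1 _ ⟨
        proj₁ (θ (φ d f + f , 1ℙ))          ≈⟨ proj₁ (θ-cong (trans (collect _ _ _)
                                                (∙-congˡ (identityʳ f)) , ≡.refl)) ⟨
        proj₁ (θ ((f , 0ℙ) A.∘ᴮ (0# , 1ℙ))) ≈⟨ proj₁ (≈ᴮ.trans (θ-∘ _ _)
                                                (A₁.∘ᴮ-cong (θ-F f) θ-0×1)) ⟩
        s f + c₁ + (φ d₁ (s f) - 0#) + 0#   ≈⟨ collect _ _ _ ⟩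
        φ d₁ (s f) + (s f + c₁)             ∎)
        where
        collect : ∀ a b w → a + b + (w - 0#) + 0# ≈ w + (a + b)
        collect a b w = trans (identityʳ _)
          (trans (∙-congˡ (trans (∙-congˡ ε⁻¹≈ε) (identityʳ w))) (comm _ _))

      φ₁-c : φ d₁ c₁ ≈ z d₁ - s (z d)
      φ₁-c = begin
        φ d₁ c₁                  ≈⟨ //-rightDividesˡ (z d₁) _ ⟨
        φ d₁ c₁ - z d₁ + z d₁    ≈⟨ ∙-congʳ (∙-cancelʳ (y d₁) _ _ square) ⟨
        - s (z d) + z d₁         ≈⟨ comm _ _ ⟩
        z d₁ - s (z d)           ∎
        where
        -- The square of `(0# , 1ℙ)` under `∘` is `(- z d + y d , 0ℙ)`, and that of `(c₁ , 1ℙ)` has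
        -- first component `φ d₁ c₁ - z d₁ + y d₁`.
        square : - s (z d) + y d₁ ≈ φ d₁ c₁ - z d₁ + y d₁
        square = begin
          - s (z d) + y d₁                    ≈⟨ ∙-cong (s-neg _) s-y ⟨
          s (- z d) + s (y d)                 ≈⟨ s-homo _ _ ⟨
          s (- z d + y d)                     ≈⟨ s-cong (∙-congʳ (trans (assoc _ _ _)
                                                   (trans (identityˡ _) (trans (-0#+x≈x _)
                                                   (trans (∙-congʳ φ.ε-homo) (identityˡ _)))))) ⟨
          s (0# - 0# + (φ d 0# - z d) + y d)  ≈⟨ proj₁ (≈ᴮ.trans (θ-∘ _ _)
                                                   (A₁.∘ᴮ-cong θ-0×1 θ-0×1)) ⟩
          c₁ - c₁ + (φ d₁ c₁ - z d₁) + y d₁   ≈⟨ ∙-congʳ (trans (∙-congʳ (inverseʳ c₁))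
                                                   (identityˡ _)) ⟩
          φ d₁ c₁ - z d₁ + y d₁               ∎

      restriction-conjugates : Conjugates restriction
      restriction-conjugates =
        -- The chosen preimage `⟦ restriction ⟧⁻¹ f` reduces to this `g`.
        (λ f → let g , s[g]≈f = s-surjective f in
          trans (φ₁.⟦⟧-cong (sym s[g]≈f)) (sym (s-φ g)))
        , s-y
        , c₁ , φ₁-c

    -- From an automorphism of `F` to an isomorphism of skew braces.

    module Extension (σ : Automorphism F) (σ-conjugates : Conjugates σ) where
      open Automorphism σ using (injective; surjective)
        renaming (∙-homo to σ-homo; ε-homo to σ-0; ⁻¹-homo to σ-neg; ⟦⟧-cong to σ-cong)
      private
        s = ⟦ σ ⟧
        -- The given preimage of `z d₁ - s (z d)` under `φ d₁`; it will be the first component of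
        -- the image of `(0# , 1ℙ)`.
        c₁ = proj₁ (proj₂ (proj₂ σ-conjugates))

      σ-φ : ∀ f → s (φ d f) ≈ φ d₁ (s f)
      σ-φ f = trans (σ-cong (φ.⟦⟧-cong (sym (injective (proj₂ (surjective (s f)) refl)))))
        (sym (proj₁ σ-conjugates (s f)))

      σ-· : ∀ k f → s ([ k ] · f) ≈ [ k ] · s f
      σ-· 0ℙ f = σ-0
      σ-· 1ℙ f = refl

      σ-signed : ∀ k f → s (A.signed k f) ≈ A₁.signed k (s f)
      σ-signed 0ℙ f = refl
      σ-signed 1ℙ f = σ-neg f

      σ-β : ∀ k₁ k₂ → s (A.β k₁ k₂) ≈ A₁.β k₁ k₂
      σ-β k₁ k₂ = trans (σ-· k₁ _) (A.·-cong k₁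
        (trans (σ-· k₂ _) (A.·-cong k₂ (proj₁ (proj₂ σ-conjugates)))))

      -- The map sending `k` to `[ k ] · x` is a crossed homomorphism for the sign action: for two
      -- odd parities the copies of `x` have opposite signs. Hence `extension` is additive for any
      -- value of `c₁`.
      ·-signed : ∀ k₁ k₂ x → [ k₁ ℙ.+ k₂ ] · x ≈ [ k₁ ] · x + A₁.signed k₁ ([ k₂ ] · x)
      ·-signed 0ℙ k₂ x = sym (identityˡ _)
      ·-signed 1ℙ 0ℙ x = sym (trans (∙-congˡ ε⁻¹≈ε) (identityʳ x))
      ·-signed 1ℙ 1ℙ x = sym (inverseʳ x)

      σ-z : ∀ k → - ([ k ] · s (z d)) ≈ [ k ] · φ d₁ c₁ - [ k ] · z d₁
      σ-z 0ℙ = sym (identityˡ _)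
      σ-z 1ℙ = sym (trans (∙-congʳ (proj₂ (proj₂ (proj₂ σ-conjugates)))) (xyx⁻¹≈y _ _))

      -- The shift by `[ k₁ ] · c₁` contributes `[ k₁ ] · φ d₁ c₁`, which is exactly the difference
      -- between `z d₁` and `s (z d)` when `k₁` is odd.
      σ-ψ : ∀ f k₁ k₂ → s (ψ (f , k₁ , k₂)) ≈ ψ₁ (s f + [ k₁ ] · c₁ , k₁ , k₂)
      σ-ψ f k₁ k₂ = trans (σ-· k₂ _) (A.·-cong k₂ (begin
        s (φ d f - [ k₁ ] · z d)
          ≈⟨ trans (σ-homo _ _) (∙-cong (σ-φ f) (trans (σ-neg _) (⁻¹-cong (σ-· k₁ _)))) ⟩
        φ d₁ (s f) - [ k₁ ] · s (z d)
          ≈⟨ ∙-congˡ (σ-z k₁) ⟩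
        φ d₁ (s f) + ([ k₁ ] · φ d₁ c₁ - [ k₁ ] · z d₁)
          ≈⟨ assoc _ _ _ ⟨
        φ d₁ (s f) + [ k₁ ] · φ d₁ c₁ - [ k₁ ] · z d₁
          ≈⟨ ∙-congʳ (trans (φ₁.homo _ _) (∙-congˡ (A₁.φ-· k₁ c₁))) ⟨
        φ d₁ (s f + [ k₁ ] · c₁) - [ k₁ ] · z d₁ ∎))

      extension : A.B → A₁.B
      extension (f , k) = s f + [ k ] · c₁ , k

      extension-cong : Congruent A._≈ᴮ_ _≈₁_ extension
      extension-cong (eq , ≡.refl) = ∙-congʳ (σ-cong eq) , ≡.refl

      extension-+ : Homomorphic₂ A.B A₁.B _≈₁_ extension A._+ᴮ_ _+₁_
      extension-+ (f₁ , k₁) (f₂ , k₂) = (begin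
        s (f₁ + A.signed k₁ f₂ + A.β k₁ k₂) + [ k₁ ℙ.+ k₂ ] · c₁
          ≈⟨ ∙-cong (trans (σ-homo _ _) (∙-cong
               (trans (σ-homo _ _) (∙-congˡ (σ-signed k₁ f₂))) (σ-β k₁ k₂)))
               (·-signed k₁ k₂ c₁) ⟩
        s f₁ + A₁.signed k₁ (s f₂) + A₁.β k₁ k₂
          + ([ k₁ ] · c₁ + A₁.signed k₁ ([ k₂ ] · c₁))
          ≈⟨ solve 5 (λ a b p u v →
               ((a ⊕ b) ⊕ p) ⊕ (u ⊕ v) ⊜ ((a ⊕ u) ⊕ (b ⊕ v)) ⊕ p) refl _ _ _ _ _ ⟩
        s f₁ + [ k₁ ] · c₁ + (A₁.signed k₁ (s f₂) + A₁.signed k₁ ([ k₂ ] · c₁)) + A₁.β k₁ k₂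
          ≈⟨ ∙-congʳ (∙-congˡ (A₁.signed-+ k₁ _ _)) ⟨
        s f₁ + [ k₁ ] · c₁ + A₁.signed k₁ (s f₂ + [ k₂ ] · c₁) + A₁.β k₁ k₂ ∎) , ≡.refl

      extension-lam : ∀ a b → extension (A.lam a b) ≈₁ A₁.lam (extension a) (extension b)
      extension-lam (f₁ , k₁) (f₂ , k₂) = (begin
        s (f₂ + A.signed k₁ (ψ (f₁ , k₁ , k₂))) + [ k₂ ] · c₁
          ≈⟨ ∙-congʳ (trans (σ-homo _ _) (∙-congˡ
               (trans (σ-signed k₁ _) (A₁.signed-cong k₁ (σ-ψ f₁ k₁ k₂))))) ⟩
        s f₂ + A₁.signed k₁ (ψ₁ (s f₁ + [ k₁ ] · c₁ , k₁ , k₂)) + [ k₂ ] · c₁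
          ≈⟨ solve 3 (λ a b u → (a ⊕ b) ⊕ u ⊜ (a ⊕ u) ⊕ b) refl _ _ _ ⟩
        s f₂ + [ k₂ ] · c₁ + A₁.signed k₁ (ψ₁ (s f₁ + [ k₁ ] · c₁ , k₁ , k₂)) ∎) , ≡.refl

      -- As `a ∘ b = a + lam a b` on both sides, compatibility with `+` and `lam` suffices.
      extension-∘ : Homomorphic₂ A.B A₁.B _≈₁_ extension A._∘ᴮ_ _∘₁_
      extension-∘ a b =
        ≈ᴮ.trans (extension-cong (A.∘ᴮ≈+ᴮ-lam a b))
        (≈ᴮ.trans (extension-+ a (A.lam a b))
        (≈ᴮ.trans (A₁.+ᴮ-cong {extension a} ≈ᴮ.refl (extension-lam a b))
        (≈ᴮ.sym (A₁.∘ᴮ≈+ᴮ-lam (extension a) (extension b)))))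

      extension-injective : Injective A._≈ᴮ_ _≈₁_ extension
      extension-injective (eq , ≡.refl) = injective (∙-cancelʳ _ _ _ eq) , ≡.refl

      extension-surjective : StrictlySurjective _≈₁_ extension
      extension-surjective (g , k) =
        -- Parity is preserved, so only `s f + [ k ] · c₁ ≈ g` has to be solved for `f`.
        let f , s[f]≈g-kc = surjective (g - [ k ] · c₁) in
        (f , k) , trans (∙-congʳ (s[f]≈g-kc refl)) (//-rightDividesˡ _ g) , ≡.refl

      extension-isIsomorphism : IsSkewBraceIsomorphism (skewBrace F d) (skewBrace F d₁)
        extension
      extension-isIsomorphism = record
        { +-isGroupHomomorphism = homomorphic₂⇒isGroupHomomorphism
            (SkewBrace.+-group (skewBrace F d)) (SkewBrace.+-group (skewBrace F d₁))
            extension-cong extension-+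
        ; ∘-isGroupHomomorphism = homomorphic₂⇒isGroupHomomorphism
            (SkewBrace.∘-group (skewBrace F d)) (SkewBrace.∘-group (skewBrace F d₁))
            extension-cong extension-∘
        ; bijective = extension-injective , Consequences.strictlySurjective⇒surjective
            A.setoidᴮ A₁.setoidᴮ extension-cong extension-surjective
        }

mainTheorem17 : ∀ {c ℓ} (F : AbelianGroup c ℓ) →
    let
      open AbelianGroup F
    in
    Finite setoid → ¬ (∀ f → f ≈ ε) →
    (d d₁ : AdmissibleData F) →
    skewBrace F d ≅ skewBrace F d₁
      ⇔ (Σ[ σ ∈ Automorphism F ]
           (∀ f → φ d₁ f ≈ ⟦ σ ⟧ (φ d (⟦ σ ⟧⁻¹ f)))
           × ⟦ σ ⟧ (y d) ≈ y d₁
           × (∃[ f ] φ d₁ f ≈ z d₁ - ⟦ σ ⟧ (z d)))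
mainTheorem17 F _ _ d d₁ = mk⇔
  (λ (_ , θ-iso) →
    Restriction.restriction F d d₁ θ-iso ,
    Restriction.restriction-conjugates F d d₁ θ-iso)
  (λ (σ , σ-conjugates) →
    Extension.extension F d d₁ σ σ-conjugates ,
    Extension.extension-isIsomorphism F d d₁ σ σ-conjugates)
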